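{- Let $q$ be a prime power, let $m,n$ be positive integers, and let $X$ be a vector space of dimension $n$ over $\mathbb{F}_{q^m}$. Let $\mathcal{A}=\{\langle v_1\rangle_{\mathbb{F}_{q^m}},\ldots,\langle v_s\rangle_{\mathbb{F}_{q^m}}\}$ be a partial Desarguesian $m$-spread of $X$ of size $s$ (that is, a set of $s$ distinct one-dimensional $\mathbb{F}_{q^m}$-subspaces of $X$), let $h$ be a positive integer such that $1\leq h\leq m$, and let $U$ be an $\mathbb{F}_q$-subspace of $X$ of dimension $k$ over $\mathbb{F}_q$. If $U$ is $(\mathcal{A}^{(2)},h)$-evasive, then $$s(q^m-1)+1\leq \begin{cases} q^{(mn-k)(h+1)} & \text{if } k\leq mn-m,\\ q^{m(mn-k-m+h+1)} & \text{otherwise.}\end{cases}$$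
   Context: $\mathcal{A}^{(2)}$ denotes the set of all one-dimensional $\mathbb{F}_{q^m}$-subspaces of $X$ which are contained in a space of the form $\langle v_i,v_j\rangle_{\mathbb{F}_{q^m}}$ for some $i,j\in\{1,\ldots,s\}$. For a collection $\mathcal{B}$ of $m$-dimensional $\mathbb{F}_q$-subspaces of $X$, an $\mathbb{F}_q$-subspace $U\le X$ is $(\mathcal{B},h)$-evasive if $\dim_{\mathbb{F}_q}(U\cap S)\leq h$ for all $S\in\mathcal{B}$.
   Formalization: The formal theorem assumes 1 ≤ h < m: for h = m evasiveness is vacuous and the bound fails (q=2, m=h=1, n=k=2, U=X, s=2 would give 3 ≤ 2). A negative exponent mn-k-m+h+1, possible only for s=0, is read as 0. -}

module Defs where

open import Level using (Level; _⊔_; suc)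
open import Algebra.Bundles using (CommutativeRing)
open import Algebra.Definitions using (Invertible)
open import Algebra.Module.Bundles using (Module)
open import Algebra.Module.Structures.Biased using (IsModuleFromLeft)
open import Algebra.Morphism.Structures using (module RingMorphisms)
import Algebra.Properties.CommutativeMonoid.Sum as Sum
open import Data.Fin.Base using (Fin)
open import Data.Nat.Base as ℕ using (ℕ)
open import Data.Nat.Primality using (Prime)
open import Data.Product.Base using (_×_; _,_; ∃-syntax)
open import Data.Unit.Polymorphic.Base using (⊤; tt)
open import Data.Vec.Functional using (Vector; []; _∷_)
open import Function.Bundles using (Inverse)
open import Relation.Binary.PropositionalEquality using (_≡_; _≢_; setoid)
import Relation.Binary.Reasoning.Setoid as SetoidReasoning
open import Relation.Nullary.Negation using (¬_)
open import Relation.Unary using (Pred; _⊆_; _≐_; _∩_)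

private
  variable
    c ℓ p : Level

IsPrimePower : ℕ → Set
IsPrimePower q = ∃[ r ] ∃[ e ] Prime r × 1 ℕ.≤ e × q ≡ r ℕ.^ e

record IsField (R : CommutativeRing c ℓ) : Set (c ⊔ ℓ) where
  open CommutativeRing R
  field
    1≉0     : ¬ (1# ≈ 0#)
    inverse : ∀ x → ¬ (x ≈ 0#) → Invertible _≈_ 1# _*_ x

record IsFiniteFieldOfOrder (q : ℕ) (R : CommutativeRing c ℓ) : Set (c ⊔ ℓ) where
  field
    isField     : IsField R
    enumeration : Inverse (CommutativeRing.setoid R) (setoid (Fin q))

IsRingHom : (F K : CommutativeRing c ℓ) →
            (CommutativeRing.Carrier F → CommutativeRing.Carrier K) → Set (c ⊔ ℓ)
IsRingHom F K = RingMorphisms.IsRingHomomorphism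
  (CommutativeRing.rawRing F) (CommutativeRing.rawRing K)

module _ {R : CommutativeRing c ℓ} (V : Module R c ℓ) where
  open CommutativeRing R using (Carrier; _≈_; 0#; _+_; _*_)
  open Module V
  open Sum +ᴹ-commutativeMonoid using (sum; sum-cong-≋; sum-replicate-zero; ∑-distrib-+)

  record Subspace : Set (suc (c ⊔ ℓ)) where
    field
      carrier   : Pred Carrierᴹ (c ⊔ ℓ)
      resp      : ∀ {x y} → x ≈ᴹ y → carrier x → carrier y
      0-closed  : carrier 0ᴹ
      +-closed  : ∀ {x y} → carrier x → carrier y → carrier (x +ᴹ y)
      *ₗ-closed : ∀ a {x} → carrier x → carrier (a *ₗ x)

  linComb : ∀ {d} → Vector Carrier d → Vector Carrierᴹ d → Carrierᴹ
  linComb a b = sum (λ i → a i *ₗ b i)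

  linComb-0 : ∀ {d} (b : Vector Carrierᴹ d) → linComb (λ _ → 0#) b ≈ᴹ 0ᴹ
  linComb-0 {d} b = ≈ᴹ-trans (sum-cong-≋ (λ i → *ₗ-zeroˡ (b i))) (sum-replicate-zero d)

  linComb-+ : ∀ {d} (a a′ : Vector Carrier d) (b : Vector Carrierᴹ d) →
              linComb (λ i → a i + a′ i) b ≈ᴹ linComb a b +ᴹ linComb a′ b
  linComb-+ a a′ b = ≈ᴹ-trans
    (sum-cong-≋ (λ i → *ₗ-distribʳ (b i) (a i) (a′ i)))
    (∑-distrib-+ (λ i → a i *ₗ b i) (λ i → a′ i *ₗ b i))

  linComb-* : ∀ {d} r (a : Vector Carrier d) (b : Vector Carrierᴹ d) →
              linComb (λ i → r * a i) b ≈ᴹ r *ₗ linComb a b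
  linComb-* {ℕ.zero}  r a b = ≈ᴹ-sym (*ₗ-zeroʳ r)
  linComb-* {ℕ.suc d} r a b = ≈ᴹ-trans
    (+ᴹ-cong (*ₗ-assoc r (a Fin.zero) (b Fin.zero))
             (linComb-* r (λ i → a (Fin.suc i)) (λ i → b (Fin.suc i))))
    (≈ᴹ-sym (*ₗ-distribˡ r _ _))

  span : ∀ {d} → Vector Carrierᴹ d → Subspace
  span b = record
    { carrier   = λ x → ∃[ a ] x ≈ᴹ linComb a b
    ; resp      = λ { x≈y (a , x≈) → a , ≈ᴹ-trans (≈ᴹ-sym x≈y) x≈ }
    ; 0-closed  = (λ _ → 0#) , ≈ᴹ-sym (linComb-0 b)
    ; +-closed  = λ { (a , x≈) (a′ , y≈) →
                      (λ i → a i + a′ i) , ≈ᴹ-trans (+ᴹ-cong x≈ y≈) (≈ᴹ-sym (linComb-+ a a′ b)) }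
    ; *ₗ-closed = λ { r (a , x≈) →
                      (λ i → r * a i) , ≈ᴹ-trans (*ₗ-congˡ x≈) (≈ᴹ-sym (linComb-* r a b)) }
    }

  whole : Subspace
  whole = record
    { carrier   = λ _ → ⊤
    ; resp      = λ _ _ → tt
    ; 0-closed  = tt
    ; +-closed  = λ _ _ → tt
    ; *ₗ-closed = λ _ _ → tt
    }

  _⊓_ : Subspace → Subspace → Subspace
  W ⊓ W′ = record
    { carrier   = W.carrier ∩ W′.carrier
    ; resp      = λ { e (x , x′) → W.resp e x , W′.resp e x′ }
    ; 0-closed  = W.0-closed , W′.0-closed
    ; +-closed  = λ { (x , x′) (y , y′) → W.+-closed x y , W′.+-closed x′ y′ }
    ; *ₗ-closed = λ { a (x , x′) → W.*ₗ-closed a x , W′.*ₗ-closed a x′ }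
    }
    where
    module W = Subspace W
    module W′ = Subspace W′

  _⊑_ : Subspace → Subspace → Set (c ⊔ ℓ)
  W ⊑ W′ = Subspace.carrier W ⊆ Subspace.carrier W′

  _≋_ : Subspace → Subspace → Set (c ⊔ ℓ)
  W ≋ W′ = Subspace.carrier W ≐ Subspace.carrier W′

  LinearlyIndependent : ∀ {d} → Vector Carrierᴹ d → Set (c ⊔ ℓ)
  LinearlyIndependent b = ∀ a → linComb a b ≈ᴹ 0ᴹ → ∀ i → a i ≈ 0#

  HasDimension : Subspace → ℕ → Set (c ⊔ ℓ)
  HasDimension W d = ∃[ b ] LinearlyIndependent {d} b × W ≋ span b

  DimensionAtMost : Subspace → ℕ → Set (c ⊔ ℓ)
  DimensionAtMost W h = ∃[ d ] d ℕ.≤ h × HasDimension W d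

  Evasive : Pred Subspace p → ℕ → Subspace → Set (suc (c ⊔ ℓ) ⊔ p)
  Evasive B h U = ∀ S → B S → DimensionAtMost (U ⊓ S) h

  -- The set {⟨v₁⟩, …, ⟨v_s⟩} has exactly s members, each of dimension one.
  IsPartialDesarguesianSpread : ∀ {s} → Vector Carrierᴹ s → Set (c ⊔ ℓ)
  IsPartialDesarguesianSpread v =
    (∀ i → HasDimension (span (v i ∷ [])) 1) ×
    (∀ i j → i ≢ j → ¬ (span (v i ∷ []) ≋ span (v j ∷ [])))

  -- 𝒜⁽²⁾, where 𝒜 = {⟨v₁⟩, …, ⟨v_s⟩}; the indices i and j may coincide.
  _⁽²⁾ : ∀ {s} → Vector Carrierᴹ s → Pred Subspace (c ⊔ ℓ)
  (v ⁽²⁾) S = HasDimension S 1 × ∃[ i ] ∃[ j ] S ⊑ span (v i ∷ v j ∷ [])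

-- A vector space over K is regarded as one over F along ι : F → K.
module Restriction
  (F K : CommutativeRing c ℓ)
  {ι : CommutativeRing.Carrier F → CommutativeRing.Carrier K}
  (ι-hom : IsRingHom F K ι)
  (X : Module K c ℓ)
  where
  open Module X
  open RingMorphisms.IsRingHomomorphism ι-hom

  restrict : Module F c ℓ
  restrict = record
    { Carrierᴹ = Carrierᴹ
    ; _≈ᴹ_     = _≈ᴹ_
    ; _+ᴹ_     = _+ᴹ_
    ; _*ₗ_     = λ a x → ι a *ₗ x
    ; _*ᵣ_     = λ x a → ι a *ₗ x
    ; 0ᴹ       = 0ᴹ
    ; -ᴹ_      = -ᴹ_
    ; isModule = IsModuleFromLeft.isModule {commutativeRing = F} record
      { isLeftModule = record
        { isLeftSemimodule = record
          { +ᴹ-isCommutativeMonoid = +ᴹ-isCommutativeMonoid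
          ; isPreleftSemimodule = record
            { *ₗ-cong      = λ e → *ₗ-cong (⟦⟧-cong e)
            ; *ₗ-zeroˡ     = λ x → ≈ᴹ-trans (*ₗ-congʳ 0#-homo) (*ₗ-zeroˡ x)
            ; *ₗ-distribʳ  = λ x a b → ≈ᴹ-trans (*ₗ-congʳ (+-homo a b)) (*ₗ-distribʳ x (ι a) (ι b))
            ; *ₗ-identityˡ = λ x → ≈ᴹ-trans (*ₗ-congʳ 1#-homo) (*ₗ-identityˡ x)
            ; *ₗ-assoc     = λ a b x → ≈ᴹ-trans (*ₗ-congʳ (*-homo a b)) (*ₗ-assoc (ι a) (ι b) x)
            ; *ₗ-zeroʳ     = λ a → *ₗ-zeroʳ (ι a)
            ; *ₗ-distribˡ  = λ a → *ₗ-distribˡ (ι a)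
            }
          }
        ; -ᴹ‿cong    = -ᴹ‿cong
        ; -ᴹ‿inverse = -ᴹ‿inverse
        }
      }
    }

  restrictSubspace : Subspace X → Subspace restrict
  restrictSubspace W = record
    { carrier   = carrier
    ; resp      = resp
    ; 0-closed  = 0-closed
    ; +-closed  = +-closed
    ; *ₗ-closed = λ a → *ₗ-closed (ι a)
    }
    where open Subspace W

  restrictAll : Pred (Subspace X) p → Pred (Subspace restrict) (suc (c ⊔ ℓ) ⊔ p)
  restrictAll B T = ∃[ S ] B S × _≋_ restrict T (restrictSubspace S)

{-# OPTIONS --safe #-}
module Submission where

-- Fix h < D ≤ m and elements e₁, …, e_D of K independent over F. Send x ∈ X to the tuple
-- (e₁ x, …, e_D x) modulo U. If two distinct words among 0 and the a vᵢ had the same image, then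
-- with w their difference, the D-dimensional F-space ⟨e₁, …, e_D⟩ w would lie in U ∩ ⟨w⟩, against
-- evasiveness, since ⟨w⟩ ∈ 𝒜⁽²⁾. So there are at most |X/U| ^ D words, which for D = h + 1 is the
-- first bound. For the second, take D = m and first enlarge U by r = m − h − 1 vectors, which
-- raises the intersection dimensions by at most r (the Singleton bound for rank-metric codes).
-- Quotients are avoided by counting pairs of a word and a D-tuple from U inside X ^ D.

open import Defs
open import Algebra.Bundles using (CommutativeRing)
open import Algebra.Module.Bundles using (Module)
import Algebra.Module.Construct.TensorUnit as TensorUnit
import Algebra.Properties.AbelianGroup as AbelianGroupProperties
open import Data.Empty using (⊥-elim)
open import Data.Fin.Base using (Fin; zero; suc; combine; remQuot; funToFin; finToFun; punchIn)
open import Data.Fin.Properties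
  using (injective⇒≤; combine-injective; combine-remQuot; finToFun-funToFin;
         funToFin-finToFin; any?; ¬∀⟶∃¬; punchIn-injective; punchInᵢ≢i)
  renaming (_≟_ to _≟ꟳ_)
open import Data.Nat.Base
  using (ℕ; zero; suc; _+_; _*_; _∸_; _^_; _≤_; _<_; z≤n; s≤s; NonZero; >-nonZero; nonTrivial⇒n>1; nonTrivial⇒nonZero)
import Data.Nat.Properties as ℕ
open import Data.Nat.Primality using (prime⇒nonTrivial)
open import Data.Product.Base using (_×_; _,_; proj₁; proj₂; ∃; ∃-syntax)
open import Data.Unit.Polymorphic.Base using (tt)
open import Data.Vec.Functional using (Vector; []; _∷_; head; tail; take; drop)
import Data.Vec.Functional.Relation.Binary.Equality.Setoid as VectorEquality
open import Function.Base using (_∘_)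
open import Function.Bundles using (Inverse)
open import Level using (Level; _⊔_)
open import Relation.Binary.Bundles using (Setoid)
open import Relation.Binary.PropositionalEquality
  using (_≡_; _≢_; refl; sym; trans; cong; cong₂; subst; setoid; module ≡-Reasoning)
import Relation.Binary.Reasoning.Setoid as SetoidReasoning
open import Relation.Nullary using (Dec; yes; no; contradiction)
open import Relation.Nullary.Decidable using (map′)
open import Relation.Nullary.Negation using (¬_)

private
  variable
    c ℓ : Level
    q d k r D M N B C : ℕ

-- Counting by injections between finite index sets.

funToFin-cong : {f g : Fin d → Fin N} → (∀ i → f i ≡ g i) → funToFin f ≡ funToFin g
funToFin-cong {zero}  f≗g = refl
funToFin-cong {suc d} f≗g = cong₂ combine (f≗g zero) (funToFin-cong (f≗g ∘ suc))

product-injective⇒≤ : (f : Fin M → Fin N → Fin B) →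
  (∀ {i j i′ j′} → f i j ≡ f i′ j′ → i ≡ i′ × j ≡ j′) → M * N ≤ B
product-injective⇒≤ {M} {N} f f-inj =
  injective⇒≤ {f = λ t → f (proj₁ (remQuot {M} N t)) (proj₂ (remQuot {M} N t))} λ {t} {t′} eq →
    let i≡i′ , j≡j′ = f-inj eq in begin
      t                                              ≡⟨ combine-remQuot {M} N t ⟨
      combine (proj₁ (remQuot {M} N t)) (proj₂ (remQuot {M} N t)) ≡⟨ cong₂ combine i≡i′ j≡j′ ⟩
      combine (proj₁ (remQuot {M} N t′)) (proj₂ (remQuot {M} N t′)) ≡⟨ combine-remQuot {M} N t′ ⟩
      t′                                             ∎
  where open ≡-Reasoning

-- Each `j` is recorded by `g j` together with its label `δ i j` relative to a base point `i` of the
-- same fibre; this replaces passing to a quotient. Labels may depend on the proof of `g i ≡ g j`,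
-- so they are compared across all proofs.
fibres-bounded⇒≤ : (g : Fin N → Fin M) (δ : ∀ i j → g i ≡ g j → Fin B) →
  (∀ i {j j′} p p′ → δ i j p ≡ δ i j′ p′ → j ≡ j′) → N ≤ M * B
fibres-bounded⇒≤ {N} {M} {B} g δ δ-inj = injective⇒≤ {f = λ j → combine (g j) (position (g j) j refl)} λ {j} {j′} eq →
    let y≡y′ , x≡x′ = combine-injective (g j) _ (g j′) _ eq
    in position-injective (g j) (g j′) y≡y′ j j′ refl refl x≡x′
  where
  -- The base point depends on the value y alone, so it is shared by the whole fibre over y.
  position′ : ∀ {y} → Dec (∃[ i ] g i ≡ y) → ∀ j → g j ≡ y → Fin B
  position′ (yes (i , gi≡y)) j gj≡y = δ i j (trans gi≡y (sym gj≡y))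
  position′ (no empty)       j gj≡y = ⊥-elim (empty (j , gj≡y))

  position : ∀ y j → g j ≡ y → Fin B
  position y = position′ (any? λ i → g i ≟ꟳ y)

  position′-injective : ∀ {y} (y? : Dec (∃[ i ] g i ≡ y)) j j′ e e′ →
    position′ y? j e ≡ position′ y? j′ e′ → j ≡ j′
  position′-injective (yes (i , _)) j j′ e e′ eq = δ-inj i _ _ eq
  position′-injective (no empty)    j j′ e e′ eq = ⊥-elim (empty (j , e))

  -- The two values are separate variables so that their equality can be matched with `refl`, which
  -- `g j ≡ g j′` does not allow.
  position-injective : ∀ y y′ → y ≡ y′ → ∀ j j′ e e′ → position y j e ≡ position y′ j′ e′ → j ≡ j′
  position-injective y .y refl = position′-injective (any? λ i → g i ≟ꟳ y)

-- Finite setoids and vectors over them.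

Finite : Setoid c ℓ → ℕ → Set (c ⊔ ℓ)
Finite S N = Inverse S (setoid (Fin N))

vectorSetoid : Setoid c ℓ → ℕ → Setoid c ℓ
vectorSetoid S d = VectorEquality.≋-setoid S d

module _ {S : Setoid c ℓ} (S-finite : Finite S N) where
  open Setoid S renaming (refl to ≈-refl; sym to ≈-sym; trans to ≈-trans)
  open Inverse S-finite

  index-injective : ∀ {x y} → to x ≡ to y → x ≈ y
  index-injective {x} {y} eq = ≈-trans (≈-sym (strictlyInverseʳ x)) (inverseʳ eq)

  element-injective : ∀ {i j} → from i ≈ from j → i ≡ j
  element-injective {i} {j} eq = trans (sym (strictlyInverseˡ i)) (inverseˡ eq)

  decidable : ∀ x y → Dec (x ≈ y)
  decidable x y = map′ index-injective to-cong (to x ≟ꟳ to y)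

  vector-finite : ∀ d → Finite (vectorSetoid S d) (N ^ d)
  vector-finite d = record
    { to        = λ a → funToFin (to ∘ a)
    ; from      = λ i → from ∘ finToFun i
    ; to-cong   = λ a≋b → funToFin-cong (to-cong ∘ a≋b)
    ; from-cong = λ { refl _ → ≈-refl }
    ; inverse   =
        (λ {x} a≋x → trans (funToFin-cong λ l → inverseˡ (a≋x l)) (funToFin-finToFin {d} x))
      , (λ { {a} refl l → inverseʳ (finToFun-funToFin (to ∘ a) l) })
    }

-- Linear combinations and spans over a commutative ring.

module LinearAlgebra {R : CommutativeRing c ℓ} (V : Module R c ℓ) where
  open CommutativeRing R hiding (zero; refl; sym; trans; setoid; _+_; _*_)
  private module R = CommutativeRing R
  open Module V
  open AbelianGroupProperties +ᴹ-abelianGroup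
    using (inverseˡ-unique; xyx⁻¹≈y; //-rightDividesʳ)
  module V-group = AbelianGroupProperties +ᴹ-abelianGroup
  module R-group = AbelianGroupProperties R.+-abelianGroup

  infixl 6 _-ᴹ_
  _-ᴹ_ : Carrierᴹ → Carrierᴹ → Carrierᴹ
  x -ᴹ y = x +ᴹ -ᴹ y

  open SetoidReasoning ≈ᴹ-setoid

  -‿*ₗ : ∀ a x → (- a) *ₗ x ≈ᴹ -ᴹ (a *ₗ x)
  -‿*ₗ a x = inverseˡ-unique _ _ (begin
    (- a) *ₗ x +ᴹ a *ₗ x ≈⟨ *ₗ-distribʳ x (- a) a ⟨
    (- a R.+ a) *ₗ x     ≈⟨ *ₗ-congʳ (-‿inverseˡ a) ⟩
    0# *ₗ x              ≈⟨ *ₗ-zeroˡ x ⟩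
    0ᴹ                   ∎)

  *ₗ-neg : ∀ a x → a *ₗ (-ᴹ x) ≈ᴹ -ᴹ (a *ₗ x)
  *ₗ-neg a x = inverseˡ-unique _ _ (begin
    a *ₗ (-ᴹ x) +ᴹ a *ₗ x ≈⟨ *ₗ-distribˡ a (-ᴹ x) x ⟨
    a *ₗ (-ᴹ x +ᴹ x)      ≈⟨ *ₗ-congˡ (-ᴹ‿inverseˡ x) ⟩
    a *ₗ 0ᴹ               ≈⟨ *ₗ-zeroʳ a ⟩
    0ᴹ                    ∎)

  *ₗ-distribˡ-- : ∀ a x y → a *ₗ (x -ᴹ y) ≈ᴹ a *ₗ x -ᴹ a *ₗ y
  *ₗ-distribˡ-- a x y = ≈ᴹ-trans (*ₗ-distribˡ a x (-ᴹ y)) (+ᴹ-congˡ (*ₗ-neg a y))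

  *ₗ-distribʳ-- : ∀ x a b → (a - b) *ₗ x ≈ᴹ a *ₗ x -ᴹ b *ₗ x
  *ₗ-distribʳ-- x a b = ≈ᴹ-trans (*ₗ-distribʳ x a (- b)) (+ᴹ-congˡ (-‿*ₗ b x))

  +≈+⇒-≈- : ∀ {x y x′ y′} → x +ᴹ y ≈ᴹ x′ +ᴹ y′ → x -ᴹ x′ ≈ᴹ y′ -ᴹ y
  +≈+⇒-≈- {x} {y} {x′} {y′} eq = begin
    x -ᴹ x′                ≈⟨ +ᴹ-congʳ (//-rightDividesʳ y x) ⟨
    x +ᴹ y -ᴹ y -ᴹ x′      ≈⟨ +ᴹ-congʳ (+ᴹ-congʳ eq) ⟩
    x′ +ᴹ y′ -ᴹ y -ᴹ x′    ≈⟨ +ᴹ-congʳ (+ᴹ-assoc x′ y′ (-ᴹ y)) ⟩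
    x′ +ᴹ (y′ -ᴹ y) -ᴹ x′  ≈⟨ xyx⁻¹≈y x′ (y′ -ᴹ y) ⟩
    y′ -ᴹ y                ∎

  linComb-congʳ : (b : Vector Carrierᴹ d) {a a′ : Vector Carrier d} →
    (∀ i → a i ≈ a′ i) → linComb V a b ≈ᴹ linComb V a′ b
  linComb-congʳ {zero}  b a≈ = ≈ᴹ-refl
  linComb-congʳ {suc d} b a≈ = +ᴹ-cong (*ₗ-congʳ (a≈ zero)) (linComb-congʳ (b ∘ suc) (a≈ ∘ suc))

  linComb-- : (a a′ : Vector Carrier d) (b : Vector Carrierᴹ d) →
    linComb V (λ i → a i - a′ i) b ≈ᴹ linComb V a b -ᴹ linComb V a′ b
  linComb-- a a′ b = ≈ᴹ-trans (linComb-+ V a (λ i → - a′ i) b)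
    (+ᴹ-congˡ (inverseˡ-unique _ _ (begin
      linComb V (λ i → - a′ i) b +ᴹ linComb V a′ b ≈⟨ linComb-+ V (λ i → - a′ i) a′ b ⟨
      linComb V (λ i → - a′ i R.+ a′ i) b          ≈⟨ linComb-congʳ b (λ i → -‿inverseˡ (a′ i)) ⟩
      linComb V (λ _ → 0#) b                       ≈⟨ linComb-0 V b ⟩
      0ᴹ                                           ∎)))

  linComb-drop : ∀ r (a : Vector Carrier (r + k)) (b : Vector Carrierᴹ (r + k)) →
    (∀ i → take r a i ≈ 0#) → linComb V a b ≈ᴹ linComb V (drop r a) (drop r b)
  linComb-drop zero    a b a≈0 = ≈ᴹ-refl
  linComb-drop (suc r) a b a≈0 = begin
    head a *ₗ head b +ᴹ linComb V (tail a) (tail b) ≈⟨ +ᴹ-congʳ (*ₗ-congʳ (a≈0 zero)) ⟩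
    0# *ₗ head b +ᴹ linComb V (tail a) (tail b)     ≈⟨ +ᴹ-congʳ (*ₗ-zeroˡ (head b)) ⟩
    0ᴹ +ᴹ linComb V (tail a) (tail b)               ≈⟨ +ᴹ-identityˡ _ ⟩
    linComb V (tail a) (tail b)                     ≈⟨ linComb-drop r (tail a) (tail b) (a≈0 ∘ suc) ⟩
    linComb V (drop (suc r) a) (drop (suc r) b)     ∎

  coefficients-unique : {b : Vector Carrierᴹ d} → LinearlyIndependent V b →
    ∀ {a a′} → linComb V a b ≈ᴹ linComb V a′ b → ∀ i → a i ≈ a′ i
  coefficients-unique {b = b} b-li {a} {a′} eq i = R-group.x∙y⁻¹≈ε⇒x≈y (a i) (a′ i)
    (b-li (λ i → a i - a′ i) (≈ᴹ-trans (linComb-- a a′ b) (V-group.x≈y⇒x∙y⁻¹≈ε eq)) i)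

  module _ (W : Subspace V) where
    open Subspace W

    -ᴹ-closed : ∀ {x y} → carrier x → carrier y → carrier (x -ᴹ y)
    -ᴹ-closed {x} {y} x∈W y∈W = +-closed x∈W (resp
      (≈ᴹ-trans (-‿*ₗ 1# y) (-ᴹ‿cong (*ₗ-identityˡ y))) (*ₗ-closed (- 1#) y∈W))

    linComb-closed : ∀ (a : Vector Carrier d) {b} → (∀ i → carrier (b i)) → carrier (linComb V a b)
    linComb-closed {zero}  a b∈W = 0-closed
    linComb-closed {suc d} a {b} b∈W =
      +-closed (*ₗ-closed (a zero) (b∈W zero)) (linComb-closed (a ∘ suc) {b ∘ suc} (b∈W ∘ suc))

  ∈-span₁ : ∀ a x → Subspace.carrier (span V (x ∷ [])) (a *ₗ x)
  ∈-span₁ a x = (λ _ → a) , ≈ᴹ-sym (+ᴹ-identityʳ _)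

  ∈-span₁⁻ : ∀ {x y} → Subspace.carrier (span V (x ∷ [])) y → ∃[ a ] y ≈ᴹ a *ₗ x
  ∈-span₁⁻ (a , y≈) = a zero , ≈ᴹ-trans y≈ (+ᴹ-identityʳ _)

  ∈-span₂ : ∀ a b x y → Subspace.carrier (span V (x ∷ y ∷ [])) (a *ₗ x +ᴹ b *ₗ y)
  ∈-span₂ a b x y = (a ∷ b ∷ []) , +ᴹ-congˡ (≈ᴹ-sym (+ᴹ-identityʳ _))

-- Vector spaces over a finite field: cardinalities and extension of bases.

module FiniteLinearAlgebra
  {R : CommutativeRing c ℓ} (R-field : IsFiniteFieldOfOrder q R) (V : Module R c ℓ)
  where
  open CommutativeRing R hiding (zero; refl; sym; trans; setoid; _+_; _*_)
  private module R = CommutativeRing R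
  open IsFiniteFieldOfOrder R-field
  open IsField isField
  open Module V
  open LinearAlgebra V
  open SetoidReasoning ≈ᴹ-setoid

  coefficients-finite : ∀ d → Finite (vectorSetoid R.setoid d) (q ^ d)
  coefficients-finite = vector-finite enumeration

  whole-finite : HasDimension V (whole V) d → Finite ≈ᴹ-setoid (q ^ d)
  whole-finite {d} (b , b-li , ⊆span , _) = record
    { to        = λ x → E.to (coords x)
    ; from      = λ i → linComb V (E.from i) b
    ; to-cong   = λ x≈y → E.to-cong (coefficients-unique b-li
                    (≈ᴹ-trans (≈ᴹ-sym (coords-correct _)) (≈ᴹ-trans x≈y (coords-correct _))))
    ; from-cong = λ { refl → ≈ᴹ-refl }
    ; inverse   =
        (λ {i} x≈ → trans (E.to-cong (coefficients-unique b-li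
                       (≈ᴹ-trans (≈ᴹ-sym (coords-correct _)) x≈))) (E.strictlyInverseˡ i))
      , (λ { {x} refl → ≈ᴹ-trans (linComb-congʳ b (E.strictlyInverseʳ (coords x)))
                                 (≈ᴹ-sym (coords-correct x)) })
    }
    where
    module E = Inverse (coefficients-finite d)
    coords : Carrierᴹ → Vector Carrier d
    coords x = proj₁ (⊆span {x} tt)
    coords-correct : ∀ x → x ≈ᴹ linComb V (coords x) b
    coords-correct x = proj₂ (⊆span {x} tt)

  *ₗ-solve : ∀ {a} (a≉0 : ¬ a ≈ 0#) {x y} → a *ₗ x ≈ᴹ y → x ≈ᴹ proj₁ (inverse a a≉0) *ₗ y
  *ₗ-solve {a} a≉0 {x} {y} ax≈y with inverse a a≉0
  ... | a⁻¹ , a⁻¹a≈1 , _ = begin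
    x                 ≈⟨ *ₗ-identityˡ x ⟨
    1# *ₗ x           ≈⟨ *ₗ-congʳ a⁻¹a≈1 ⟨
    (a⁻¹ R.* a) *ₗ x  ≈⟨ *ₗ-assoc a⁻¹ a x ⟩
    a⁻¹ *ₗ a *ₗ x     ≈⟨ *ₗ-congˡ ax≈y ⟩
    a⁻¹ *ₗ y          ∎

  a*x≈0∧a≉0⇒x≈0 : ∀ {a x} → a *ₗ x ≈ᴹ 0ᴹ → ¬ a ≈ 0# → x ≈ᴹ 0ᴹ
  a*x≈0∧a≉0⇒x≈0 ax≈0 a≉0 = ≈ᴹ-trans (*ₗ-solve a≉0 ax≈0) (*ₗ-zeroʳ _)

  a*x≈0∧x≉0⇒a≈0 : ∀ {a x} → a *ₗ x ≈ᴹ 0ᴹ → ¬ x ≈ᴹ 0ᴹ → a ≈ 0#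
  a*x≈0∧x≉0⇒a≈0 {a} ax≈0 x≉0 with decidable enumeration a 0#
  ... | yes a≈0 = a≈0
  ... | no  a≉0 = contradiction (a*x≈0∧a≉0⇒x≈0 ax≈0 a≉0) x≉0

  *ₗ-cancelʳ : ∀ {a b x} → ¬ x ≈ᴹ 0ᴹ → a *ₗ x ≈ᴹ b *ₗ x → a ≈ b
  *ₗ-cancelʳ {a} {b} {x} x≉0 eq = R-group.x∙y⁻¹≈ε⇒x≈y a b (a*x≈0∧x≉0⇒a≈0
    (≈ᴹ-trans (*ₗ-distribʳ-- x a b) (V-group.x≈y⇒x∙y⁻¹≈ε eq)) x≉0)

  span₁-dimension : ∀ {x} → ¬ x ≈ᴹ 0ᴹ → HasDimension V (span V (x ∷ [])) 1
  span₁-dimension {x} x≉0 = x ∷ [] , li , (λ y∈ → y∈) , (λ y∈ → y∈)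
    where
    li : LinearlyIndependent V (x ∷ [])
    li a ax≈0 zero = a*x≈0∧x≉0⇒a≈0 (≈ᴹ-trans (≈ᴹ-sym (+ᴹ-identityʳ _)) ax≈0) x≉0

  -- The basis vector of the line is a multiple of `x`, so it would vanish with `x` and violate
  -- independence, as `1#` is not zero.
  span₁-dimension⁻ : ∀ {x} → HasDimension V (span V (x ∷ [])) 1 → ¬ x ≈ᴹ 0ᴹ
  span₁-dimension⁻ {x} (b , b-li , _ , span⊆) x≈0 =
    1≉0 (b-li (λ _ → 1#) (begin
      1# *ₗ head b +ᴹ 0ᴹ    ≈⟨ 1b≈ax ⟩
      a *ₗ x                ≈⟨ *ₗ-congˡ x≈0 ⟩
      a *ₗ 0ᴹ               ≈⟨ *ₗ-zeroʳ a ⟩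
      0ᴹ                    ∎) zero)
    where
    b∈ = ∈-span₁⁻ {x} (span⊆ ((λ _ → 1#) , ≈ᴹ-refl))
    a = proj₁ b∈
    1b≈ax = proj₂ b∈

  *ₗ≈*ₗ⇒span₁⊑ : ∀ {a b x y} → ¬ a ≈ 0# → a *ₗ x ≈ᴹ b *ₗ y → _⊑_ V (span V (x ∷ [])) (span V (y ∷ []))
  *ₗ≈*ₗ⇒span₁⊑ {a} {b} {x} {y} a≉0 ax≈by {w} w∈ with ∈-span₁⁻ {x} w∈
  ... | t , w≈tx = resp (≈ᴹ-sym (≈ᴹ-trans w≈tx (*ₗ-congˡ (*ₗ-solve a≉0 ax≈by))))
                        (*ₗ-closed t (*ₗ-closed _ (∈-span₁ b y)))
    where open Subspace (span V (y ∷ []))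

  independent⇒≤ : Finite ≈ᴹ-setoid M → {b : Vector Carrierᴹ d} → LinearlyIndependent V b → q ^ d ≤ M
  independent⇒≤ {d = d} V-finite b-li = injective⇒≤ λ eq → element-injective (coefficients-finite d)
    (coefficients-unique b-li (index-injective V-finite eq))

  -- The span of `b` has at most `q ^ d` elements, so some vector lies outside it; finiteness and
  -- decidable equality let it be found by search.
  extend : Finite ≈ᴹ-setoid M → {b : Vector Carrierᴹ d} → LinearlyIndependent V b →
           q ^ d < M → ∃[ x ] LinearlyIndependent V (x ∷ b)
  extend {M} {d} V-finite {b} b-li q^d<M = x , li
    where
    module E = Inverse V-finite
    module A = Inverse (coefficients-finite d)

    Spanned : Fin M → Set _
    Spanned i = ∃[ j ] E.from i ≈ᴹ linComb V (A.from j) b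

    not-all : ¬ (∀ i → Spanned i)
    not-all all = ℕ.<⇒≱ q^d<M (injective⇒≤ {f = proj₁ ∘ all} λ {i} {i′} eq →
      element-injective V-finite (≈ᴹ-trans (proj₂ (all i))
        (≈ᴹ-trans (linComb-congʳ b (A.from-cong eq)) (≈ᴹ-sym (proj₂ (all i′))))))

    unspanned = ¬∀⟶∃¬ M Spanned
      (λ i → any? λ j → decidable V-finite (E.from i) (linComb V (A.from j) b)) not-all

    x = E.from (proj₁ unspanned)

    x∉span : ¬ Subspace.carrier (span V b) x
    x∉span (a , x≈) = proj₂ unspanned
      (A.to a , ≈ᴹ-trans x≈ (linComb-congʳ b (λ i → R.sym (A.strictlyInverseʳ a i))))

    li : LinearlyIndependent V (x ∷ b)
    li a ax+ab≈0 with decidable enumeration (head a) 0#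
    -- Dividing by a nonzero leading coefficient would put `x` in the span of `b`.
    ... | no  a₀≉0 = contradiction (resp (≈ᴹ-sym (*ₗ-solve a₀≉0 a₀x≈-ab)) (*ₗ-closed _ -ab∈)) x∉span
      where
      open Subspace (span V b)
      a₀x≈-ab = V-group.inverseˡ-unique _ _ ax+ab≈0
      -ab∈ = resp (+ᴹ-identityˡ _) (-ᴹ-closed (span V b) 0-closed (tail a , ≈ᴹ-refl))
    ... | yes a₀≈0 = λ { zero → a₀≈0 ; (suc i) → b-li (tail a) ab≈0 i }
      where
      ab≈0 = begin
        linComb V (tail a) b                ≈⟨ +ᴹ-identityˡ _ ⟨
        0ᴹ +ᴹ linComb V (tail a) b          ≈⟨ +ᴹ-congʳ (≈ᴹ-trans (*ₗ-congʳ a₀≈0) (*ₗ-zeroˡ x)) ⟨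
        head a *ₗ x +ᴹ linComb V (tail a) b ≈⟨ ax+ab≈0 ⟩
        0ᴹ                                  ∎

  -- New vectors go in front, so that `drop r` gives back `b` itself and a basis of `U` stays
  -- identifiable inside the larger family.
  extendBy : 1 < q → Finite ≈ᴹ-setoid M → {b : Vector Carrierᴹ d} → LinearlyIndependent V b →
    ∀ r → q ^ (r + d) ≤ M → ∃[ b′ ] LinearlyIndependent V {r + d} b′ × drop r b′ ≡ b
  extendBy 1<q V-finite b-li zero    _  = _ , b-li , refl
  extendBy {d = d} 1<q V-finite b-li (suc r) q^≤M =
    let q^<M = ℕ.<-≤-trans (ℕ.^-monoʳ-< q 1<q (ℕ.n<1+n (r + d))) q^≤M
        b′ , b′-li , drop≡ = extendBy 1<q V-finite b-li r (ℕ.<⇒≤ q^<M)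
        x , x∷b′-li = extend V-finite b′-li q^<M
    in x ∷ b′ , x∷b′-li , drop≡

  -- Two of the vectors p i with equal first r coefficients with respect to b differ by an
  -- element of span (drop r b), hence of W.
  span-count : (b : Vector Carrierᴹ (r + k)) (W : Subspace V) → HasDimension V W d →
    (p : Fin N → Carrierᴹ) → (∀ {i j} → p i ≈ᴹ p j → i ≡ j) →
    (∀ i → Subspace.carrier (span V b) (p i)) →
    (∀ i j → Subspace.carrier (span V (drop r b)) (p j -ᴹ p i) → Subspace.carrier W (p j -ᴹ p i)) →
    N ≤ q ^ r * q ^ d
  span-count {r} {k} {d} b W (w , _ , W⊆ , _) p p-inj p∈ diff∈ =
    -- Fibres are the classes with equal leading coefficients. The label of `p j` relative to `p i`
    -- is the coefficient vector of `p j -ᴹ p i` with respect to `w`, which determines `p j` once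
    -- `p i` is fixed.
    fibres-bounded⇒≤ (λ i → A.to (take r (coefs i))) (λ i j eq → D.to (proj₁ (diff∈w i j eq)))
      λ i {j} {j′} eq eq′ δ≡ → p-inj (V-group.∙-cancelʳ (-ᴹ p i) (p j) (p j′) (begin
        p j -ᴹ p i                               ≈⟨ proj₂ (diff∈w i j eq) ⟩
        linComb V (proj₁ (diff∈w i j eq)) w      ≈⟨ linComb-congʳ w (index-injective (coefficients-finite d) δ≡) ⟩
        linComb V (proj₁ (diff∈w i j′ eq′)) w    ≈⟨ proj₂ (diff∈w i j′ eq′) ⟨
        p j′ -ᴹ p i                              ∎))
    where
    module A = Inverse (coefficients-finite r)
    module D = Inverse (coefficients-finite d)
    coefs : ∀ i → Vector Carrier (r + k)
    coefs i = proj₁ (p∈ i)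
    diff∈w : ∀ i j → A.to (take r (coefs i)) ≡ A.to (take r (coefs j)) →
             Subspace.carrier (span V w) (p j -ᴹ p i)
    diff∈w i j eq = W⊆ (diff∈ i j (drop r a , (begin
      p j -ᴹ p i                                   ≈⟨ +ᴹ-cong (proj₂ (p∈ j)) (-ᴹ‿cong (proj₂ (p∈ i))) ⟩
      linComb V (coefs j) b -ᴹ linComb V (coefs i) b ≈⟨ linComb-- (coefs j) (coefs i) b ⟨
      linComb V a b                                ≈⟨ linComb-drop r a b (λ l → R-group.x≈y⇒x∙y⁻¹≈ε
                                                        (R.sym (index-injective (coefficients-finite r) eq l))) ⟩
      linComb V (drop r a) (drop r b)              ∎)))
      where
      a : Vector Carrier (r + k)
      a l = coefs j l - coefs i l

-- The enumeration of the field with the index of `0#` skipped by `punchIn`.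
nonzeroElements : {R : CommutativeRing c ℓ} → IsFiniteFieldOfOrder N R → let open CommutativeRing R in
  ∃ λ (f : Fin (N ∸ 1) → Carrier) → (∀ j → ¬ f j ≈ 0#) × (∀ {j j′} → f j ≈ f j′ → j ≡ j′)
nonzeroElements {N = zero}  {R} R-field = (λ ()) , (λ ()) , λ { {()} }
nonzeroElements {N = suc N} {R} R-field =
    (λ j → from (punchIn (to 0#) j))
  , (λ j eq → punchInᵢ≢i (to 0#) j (trans (sym (strictlyInverseˡ _)) (to-cong eq)))
  , (λ eq → punchIn-injective (to 0#) _ _ (element-injective (IsFiniteFieldOfOrder.enumeration R-field) eq))
  where
  open CommutativeRing R using (0#)
  open Inverse (IsFiniteFieldOfOrder.enumeration R-field)

-- Codes measured modulo a subspace over F, and their Singleton bound.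

module EvasiveCode
  (F K : CommutativeRing c ℓ) (F-field : IsFiniteFieldOfOrder q F)
  {ι : CommutativeRing.Carrier F → CommutativeRing.Carrier K} (ι-hom : IsRingHom F K ι)
  (X : Module K c ℓ)
  where
  private
    module F = CommutativeRing F
    module K = CommutativeRing K
  open Restriction F K ι-hom
  open Module X
  open LinearAlgebra X using (_-ᴹ_; *ₗ-distribˡ--; +≈+⇒-≈-)
  private
    module LX = LinearAlgebra X
    module Xꟳ = LinearAlgebra (restrict X)
  open FiniteLinearAlgebra F-field (restrict X)
  open SetoidReasoning ≈ᴹ-setoid

  Kꟳ : Module F _ _
  Kꟳ = restrict (TensorUnit.⟨module⟩ {R = K})

  -- An F-subspace containing every `e l *ₗ x` therefore contains every multiple of `x` by an
  -- element of the F-span of `e`.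
  linComb-*ₗ : (a : Vector F.Carrier d) (e : Vector K.Carrier d) (x : Carrierᴹ) →
    linComb Kꟳ a e *ₗ x ≈ᴹ linComb (restrict X) a (λ l → e l *ₗ x)
  linComb-*ₗ {zero}  a e x = *ₗ-zeroˡ x
  linComb-*ₗ {suc d} a e x = ≈ᴹ-trans (*ₗ-distribʳ x _ _)
    (+ᴹ-cong (*ₗ-assoc _ _ x) (linComb-*ₗ (a ∘ suc) (e ∘ suc) x))

  -- A Singleton-type bound for the code of words p c, whose distances are measured modulo span b.
  singleton : Finite ≈ᴹ-setoid M → {b : Vector Carrierᴹ k} → LinearlyIndependent (restrict X) b →
    (e : Vector K.Carrier D) (p : Fin C → Carrierᴹ) →
    (∀ {i j} → i ≢ j → ¬ (∀ l → Subspace.carrier (span (restrict X) b) (e l *ₗ (p i -ᴹ p j)))) →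
    C * (q ^ k) ^ D ≤ M ^ D
  singleton {M} {k} {D} X-finite {b} b-li e p separated =
    product-injective⇒≤ (λ i t → E.to (word i t)) λ {i} {t} {i′} {t′} eq →
      let word≈ = index-injective (vector-finite X-finite D) eq
          i≡i′  = injectiveˡ word≈
      in i≡i′ , injectiveʳ i≡i′ word≈
    where
    module E = Inverse (vector-finite X-finite D)
    blocks-finite = vector-finite (coefficients-finite k) D
    module B = Inverse blocks-finite

    -- For fixed `i` these tuples fill a coset of the `D`-fold power of `span b`, in place of one
    -- tuple modulo `span b`. Separation makes the cosets of different `i` disjoint, and
    -- independence of `b` recovers `t`.
    word : ∀ i → Fin ((q ^ k) ^ D) → Vector Carrierᴹ D
    word i t l = e l *ₗ p i +ᴹ linComb (restrict X) (B.from t l) b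

    injectiveˡ : ∀ {i t i′ t′} → (∀ l → word i t l ≈ᴹ word i′ t′ l) → i ≡ i′
    injectiveˡ {i} {t} {i′} {t′} word≈ with i ≟ꟳ i′
    ... | yes i≡i′ = i≡i′
    ... | no  i≢i′ = contradiction
      (λ l → (λ m → B.from t′ l m F.- B.from t l m) , (begin
        e l *ₗ (p i -ᴹ p i′)       ≈⟨ *ₗ-distribˡ-- (e l) (p i) (p i′) ⟩
        e l *ₗ p i -ᴹ e l *ₗ p i′  ≈⟨ +≈+⇒-≈- (word≈ l) ⟩
        linComb (restrict X) (B.from t′ l) b -ᴹ linComb (restrict X) (B.from t l) b
                                   ≈⟨ Xꟳ.linComb-- (B.from t′ l) (B.from t l) b ⟨
        linComb (restrict X) (λ m → B.from t′ l m F.- B.from t l m) b ∎))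
      (separated i≢i′)

    injectiveʳ : ∀ {i t i′ t′} → i ≡ i′ → (∀ l → word i t l ≈ᴹ word i′ t′ l) → t ≡ t′
    injectiveʳ {i} {t} {_} {t′} refl word≈ = element-injective blocks-finite λ l →
      Xꟳ.coefficients-unique b-li (LX.V-group.∙-cancelˡ (e l *ₗ p i) _ _ (word≈ l))

  -- The code formed by the points of a partial spread.

  module _ {Q} (K-field : IsFiniteFieldOfOrder Q K) where
    private module XK = FiniteLinearAlgebra K-field X

    module _ {s} {v : Vector Carrierᴹ s} (spread : IsPartialDesarguesianSpread X v) where

      v≉0 : ∀ i → ¬ v i ≈ᴹ 0ᴹ
      v≉0 i = XK.span₁-dimension⁻ (proj₁ spread i)

      -- Solving the equation in both directions would make the lines of distinct `i` and `j` equal.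
      -- Solving for `v j` needs `b` nonzero, which holds because `a *ₗ v i` is nonzero.
      multiples-disjoint : ∀ {i j a b} → ¬ a K.≈ K.0# → a *ₗ v i ≈ᴹ b *ₗ v j → i ≡ j
      multiples-disjoint {i} {j} {a} {b} a≉0 eq with i ≟ꟳ j
      ... | yes i≡j = i≡j
      ... | no  i≢j = ⊥-elim (proj₂ spread i j i≢j
        (XK.*ₗ≈*ₗ⇒span₁⊑ a≉0 eq , XK.*ₗ≈*ₗ⇒span₁⊑ b≉0 (≈ᴹ-sym eq)))
        where
        b≉0 : ¬ b K.≈ K.0#
        b≉0 b≈0 = v≉0 i (XK.a*x≈0∧a≉0⇒x≈0
          (≈ᴹ-trans eq (≈ᴹ-trans (*ₗ-congʳ b≈0) (*ₗ-zeroˡ (v j)))) a≉0)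

      -- The code words are 0 and the a *ₗ v i with a nonzero; 0 is represented as 0# *ₗ v i₀.
      codeword : Fin s → Fin (suc (s * (Q ∸ 1))) → Fin s × K.Carrier
      codeword i₀ zero    = i₀ , K.0#
      codeword i₀ (suc t) = let i , j = remQuot {s} (Q ∸ 1) t in i , proj₁ (nonzeroElements K-field) j

      -- Words are kept as an index and a scalar so that a difference of two words is visibly a
      -- combination of two of the vectors `v`.
      ⟦_⟧ : Fin s × K.Carrier → Carrierᴹ
      ⟦ i , a ⟧ = a *ₗ v i

      codeword-injective : ∀ i₀ {c c′} → ⟦ codeword i₀ c ⟧ ≈ᴹ ⟦ codeword i₀ c′ ⟧ → c ≡ c′
      codeword-injective i₀ {zero}  {zero}   eq = refl
      codeword-injective i₀ {zero}  {suc t′} eq = contradiction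
        (XK.a*x≈0∧x≉0⇒a≈0 (≈ᴹ-trans (≈ᴹ-sym eq) (*ₗ-zeroˡ _)) (v≉0 _))
        (proj₁ (proj₂ (nonzeroElements K-field)) _)
      codeword-injective i₀ {suc t} {zero}   eq = contradiction
        (XK.a*x≈0∧x≉0⇒a≈0 (≈ᴹ-trans eq (*ₗ-zeroˡ _)) (v≉0 _))
        (proj₁ (proj₂ (nonzeroElements K-field)) _)
      codeword-injective i₀ {suc t} {suc t′} eq = cong suc (trans (sym (combine-remQuot {s} (Q ∸ 1) t))
        (trans (cong₂ combine i≡i′ j≡j′) (combine-remQuot {s} (Q ∸ 1) t′)))
        where
        nonzero = nonzeroElements K-field
        i≡i′ = multiples-disjoint (proj₁ (proj₂ nonzero) _) eq
        j≡j′ = proj₂ (proj₂ nonzero) (XK.*ₗ-cancelʳ (v≉0 _)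
          (≈ᴹ-trans eq (*ₗ-congˡ (≈ᴹ-reflexive (cong v (sym i≡i′))))))

      module _ {h} (1<q : 1 < q) {U : Subspace (restrict X)}
        (evasive : Evasive (restrict X) (restrictAll X (_⁽²⁾ X v)) h U)
        where

        -- Were every e l multiple of w in span b, then q ^ D multiples of w would lie in span b,
        -- at most q ^ r * q ^ h by evasiveness.
        evasive⇒separated : {b : Vector Carrierᴹ (r + k)} {e : Vector K.Carrier D} →
          LinearlyIndependent Kꟳ e → r + h < D → _⊑_ (restrict X) (span (restrict X) (drop r b)) U →
          ∀ {a a′ i j} → ¬ a *ₗ v i ≈ᴹ a′ *ₗ v j →
          ¬ (∀ l → Subspace.carrier (span (restrict X) b) (e l *ₗ (a *ₗ v i -ᴹ a′ *ₗ v j)))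
        evasive⇒separated {r} {k} {D} {b} {e} e-li r+h<D ⊑U {a} {a′} {i} {j} ≉ e*w∈ =
          ℕ.<⇒≱ q^r*q^d<q^D (span-count b T∩U T∩U-dim p p-injective p∈ diff∈)
          where
          w = a *ₗ v i -ᴹ a′ *ₗ v j

          w≉0 : ¬ w ≈ᴹ 0ᴹ
          w≉0 w≈0 = ≉ (LX.V-group.x∙y⁻¹≈ε⇒x≈y _ _ w≈0)

          S = span X (w ∷ [])
          Vij = span X (v i ∷ v j ∷ [])

          w∈Vij : Subspace.carrier Vij w
          w∈Vij = Subspace.resp Vij (+ᴹ-congˡ (LX.-‿*ₗ a′ (v j))) (LX.∈-span₂ a (K.- a′) (v i) (v j))

          S⊑Vij : _⊑_ X S Vij
          S⊑Vij x∈S with LX.∈-span₁⁻ x∈S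
          ... | t , x≈tw = Subspace.resp Vij (≈ᴹ-sym x≈tw) (Subspace.*ₗ-closed Vij t w∈Vij)

          T = restrictSubspace X S
          T∩U = _⊓_ (restrict X) U T

          -- The line `S` lies in the span of `v i` and `v j`, so it belongs to the family that `U`
          -- evades. Here `i` and `j` may coincide, as for two words on one line.
          dim≤h = evasive T (S , (XK.span₁-dimension w≉0 , i , j , S⊑Vij) , (λ x∈ → x∈) , (λ x∈ → x∈))
          T∩U-dim = proj₂ (proj₂ dim≤h)

          q^r*q^d<q^D : q ^ r * q ^ proj₁ dim≤h < q ^ D
          q^r*q^d<q^D = subst (_< q ^ D) (ℕ.^-distribˡ-+-* q r (proj₁ dim≤h))
            (ℕ.^-monoʳ-< q 1<q (ℕ.≤-<-trans (ℕ.+-monoʳ-≤ r (proj₁ (proj₂ dim≤h))) r+h<D))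

          module A = Inverse (coefficients-finite D)
          -- The scalars `κ t` run through the F-span of `e`; they are distinct because `e` is
          -- independent.
          κ : Fin (q ^ D) → K.Carrier
          κ t = linComb Kꟳ (A.from t) e

          p : Fin (q ^ D) → Carrierᴹ
          p t = κ t *ₗ w

          p-injective : ∀ {t t′} → p t ≈ᴹ p t′ → t ≡ t′
          p-injective eq = element-injective (coefficients-finite D)
            (LinearAlgebra.coefficients-unique Kꟳ e-li (XK.*ₗ-cancelʳ w≉0 eq))

          p∈ : ∀ t → Subspace.carrier (span (restrict X) b) (p t)
          p∈ t = Subspace.resp (span (restrict X) b) (≈ᴹ-sym (linComb-*ₗ (A.from t) e w))
            (Xꟳ.linComb-closed (span (restrict X) b) (A.from t) e*w∈)

          diff∈ : ∀ t t′ → Subspace.carrier (span (restrict X) (drop r b)) (p t′ -ᴹ p t) →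
                  Subspace.carrier T∩U (p t′ -ᴹ p t)
          diff∈ t t′ ∈drop = ⊑U ∈drop
            , Subspace.resp S (LX.*ₗ-distribʳ-- w (κ t′) (κ t)) (LX.∈-span₁ (κ t′ K.- κ t) w)

-- Arithmetic of the exponents.

primePower>1 : IsPrimePower q → 1 < q
primePower>1 (p , suc e , p-prime , _ , refl) = ℕ.≤-trans (nonTrivial⇒n>1 p) (ℕ.m≤m*n p (p ^ e))
  where instance
    _ = prime⇒nonTrivial p-prime
    _ = ℕ.m^n≢0 p e {{nonTrivial⇒nonZero p}}

-- The factor `q ^ (a * D)` is cancelled after bounding `b` by `(b ∸ a) + a`, which is valid also
-- when the subtraction truncates.
*-^-cancel-≤ : .{{_ : NonZero q}} → ∀ a b D → C * (q ^ a) ^ D ≤ (q ^ b) ^ D → C ≤ q ^ ((b ∸ a) * D)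
*-^-cancel-≤ {q} {C} a b D le = ℕ.*-cancelʳ-≤ C (q ^ ((b ∸ a) * D)) (q ^ (a * D)) {{ℕ.m^n≢0 q (a * D)}} (begin
  C * q ^ (a * D)                ≡⟨ cong (C *_) (ℕ.^-*-assoc q a D) ⟨
  C * (q ^ a) ^ D                ≤⟨ le ⟩
  (q ^ b) ^ D                    ≡⟨ ℕ.^-*-assoc q b D ⟩
  q ^ (b * D)                    ≤⟨ ℕ.^-monoʳ-≤ q (ℕ.*-monoˡ-≤ D (ℕ.≤-trans (ℕ.m≤n+m∸n b a) (ℕ.≤-reflexive (ℕ.+-comm a (b ∸ a))))) ⟩
  q ^ ((b ∸ a + a) * D)          ≡⟨ cong (q ^_) (ℕ.*-distribʳ-+ D (b ∸ a) a) ⟩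
  q ^ ((b ∸ a) * D + a * D)      ≡⟨ ℕ.^-distribˡ-+-* q ((b ∸ a) * D) (a * D) ⟩
  q ^ ((b ∸ a) * D) * q ^ (a * D) ∎)
  where open ℕ.≤-Reasoning

-- For `a = m * n` the left side is the codimension of `U` after enlarging by `m ∸ suc h` vectors.
-- Adding `suc h` to both arguments of the truncated subtraction preserves it.
∸-shift : ∀ a k {m h} → h < m → a ∸ (m ∸ suc h + k) ≡ (a + h + 1) ∸ (k + m)
∸-shift a k {m} {h} h<m = begin
  a ∸ (m ∸ suc h + k)                     ≡⟨ ℕ.[m+n]∸[m+o]≡n∸o (suc h) a (m ∸ suc h + k) ⟨
  (suc h + a) ∸ (suc h + (m ∸ suc h + k)) ≡⟨ cong₂ _∸_ sh+a (begin
    suc h + (m ∸ suc h + k)               ≡⟨ ℕ.+-assoc (suc h) (m ∸ suc h) k ⟨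
    suc h + (m ∸ suc h) + k               ≡⟨ cong (_+ k) (ℕ.m+[n∸m]≡n h<m) ⟩
    m + k                                 ≡⟨ ℕ.+-comm m k ⟩
    k + m                                 ∎) ⟩
  (a + h + 1) ∸ (k + m)                   ∎
  where
  open ≡-Reasoning
  sh+a : suc h + a ≡ a + h + 1
  sh+a = trans (cong suc (ℕ.+-comm h a)) (ℕ.+-comm 1 (a + h))

-- Derivation of the two bounds.

corollary3p14 : {c ℓ : Level} {q m n s h k : ℕ} → IsPrimePower q → 1 ≤ m → 1 ≤ n →
    (F K : CommutativeRing c ℓ) →
    IsFiniteFieldOfOrder q F → IsFiniteFieldOfOrder (q ^ m) K →
    (ι : CommutativeRing.Carrier F → CommutativeRing.Carrier K) (ι-hom : IsRingHom F K ι) →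
    (X : Module K c ℓ) → HasDimension X (whole X) n →
    let open Restriction F K ι-hom X in
    (v : Vector (Module.Carrierᴹ X) s) → IsPartialDesarguesianSpread X v →
    1 ≤ h → h < m →
    (U : Subspace restrict) → HasDimension restrict U k →
    Evasive restrict (restrictAll (_⁽²⁾ X v)) h U →
    (k ≤ m * n ∸ m → s * (q ^ m ∸ 1) + 1 ≤ q ^ ((m * n ∸ k) * (h + 1))) ×
    (¬ (k ≤ m * n ∸ m) → s * (q ^ m ∸ 1) + 1 ≤ q ^ (m * ((m * n + h + 1) ∸ (k + m))))
-- The empty spread is treated apart because the word 0 is represented with the help of some `v i₀`;
-- the left side is then 1.
corollary3p14 {q = q} {m} {n} {zero} {h} {k} q-pp _ _ _ _ _ _ _ _ _ _ _ _ _ _ _ _ _ =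
  (λ _ → ℕ.m^n>0 q ((m * n ∸ k) * (h + 1))) , (λ _ → ℕ.m^n>0 q (m * ((m * n + h + 1) ∸ (k + m))))
  where instance _ = >-nonZero (ℕ.<⇒≤ (primePower>1 q-pp))
corollary3p14 {c} {q = q} {m} {n} {s@(suc _)} {h} {k} q-pp _ _ F K F-field K-field ι ι-hom X X-dim v spread
  _ h<m U (u , u-li , _ , span-u⊑U) evasive =
  -- `U` is not enlarged, and `h < m` makes room in K for `h + 1` independent multipliers.
  (λ _ → subst (λ D → s * (q ^ m ∸ 1) + 1 ≤ q ^ ((m * n ∸ k) * D)) (ℕ.+-comm 1 h)
                (bound 0 (suc h) ℕ.≤-refl h<m k≤mn))
  , λ _ → second (m ∸ suc h ℕ.≤? m * n ∸ k)
  where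
  1<q = primePower>1 q-pp
  instance _ = >-nonZero (ℕ.<⇒≤ 1<q)

  open Restriction F K ι-hom X
  open EvasiveCode F K F-field ι-hom X
  open Module X using (≈ᴹ-setoid)
  module VF = FiniteLinearAlgebra F-field restrict
  module KF = FiniteLinearAlgebra F-field Kꟳ

  X-finite : Finite ≈ᴹ-setoid (q ^ (m * n))
  X-finite = subst (Finite ≈ᴹ-setoid) (ℕ.^-*-assoc q m n)
    (FiniteLinearAlgebra.whole-finite K-field X X-dim)

  k≤mn : k ≤ m * n
  k≤mn = ℕ.≮⇒≥ λ mn<k → ℕ.<⇒≱ (ℕ.^-monoʳ-< q 1<q mn<k) (VF.independent⇒≤ X-finite u-li)

  -- Common source of both cases: `U` is enlarged by `r` vectors and `D` multipliers are used. The
  -- hypotheses give, in order, separation of the words, enough independent elements of K, and room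
  -- in the space for the new vectors.
  bound : ∀ r D → r + h < D → D ≤ m → r + k ≤ m * n → s * (q ^ m ∸ 1) + 1 ≤ q ^ ((m * n ∸ (r + k)) * D)
  bound r D r+h<D D≤m r+k≤mn = subst (_≤ q ^ ((m * n ∸ (r + k)) * D)) (ℕ.+-comm 1 (s * (q ^ m ∸ 1)))
    (*-^-cancel-≤ (r + k) (m * n) D
      (singleton X-finite b-li e (⟦_⟧ K-field spread ∘ codeword K-field spread zero)
        λ i≢j → evasive⇒separated K-field spread 1<q {U = U} evasive e-li r+h<D
          (subst (λ w → _⊑_ restrict (span restrict w) U) (sym drop≡) span-u⊑U)
          (λ eq → i≢j (codeword-injective K-field spread zero eq))))
    where
    U-extension : ∃[ b ] LinearlyIndependent restrict {r + k} b × drop r b ≡ u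
    U-extension = VF.extendBy 1<q X-finite u-li r (ℕ.^-monoʳ-≤ q r+k≤mn)
    b-li = proj₁ (proj₂ U-extension)
    drop≡ = proj₂ (proj₂ U-extension)

    K-family : ∃[ e ] LinearlyIndependent Kꟳ {D} e
    -- The family is grown from the empty one inside the `q ^ m` elements of K, so its length comes
    -- out as `D + 0`.
    K-family = subst (λ D → ∃[ e ] LinearlyIndependent Kꟳ {D} e) (ℕ.+-identityʳ D)
      (let e , e-li , _ = KF.extendBy 1<q (IsFiniteFieldOfOrder.enumeration K-field) {[]} (λ _ _ ()) D
             (ℕ.^-monoʳ-≤ q (ℕ.≤-trans (ℕ.≤-reflexive (ℕ.+-identityʳ D)) D≤m))
       in e , e-li)
    e = proj₁ K-family
    e-li = proj₂ K-family

  -- If r = m ∸ (h + 1) vectors cannot be added to a basis of U, adding m * n ∸ k of them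
  -- already gives all of X, and there is at most one code word.
  second : Dec (m ∸ suc h ≤ m * n ∸ k) → s * (q ^ m ∸ 1) + 1 ≤ q ^ (m * ((m * n + h + 1) ∸ (k + m)))
  second (yes r≤) = subst (λ x → s * (q ^ m ∸ 1) + 1 ≤ q ^ x)
    (trans (cong (_* m) (∸-shift (m * n) k h<m)) (ℕ.*-comm ((m * n + h + 1) ∸ (k + m)) m))
    -- With `D = m` this is the largest `r` satisfying `r + h < D`.
    (bound (m ∸ suc h) m
      (ℕ.≤-reflexive (trans (sym (ℕ.+-suc (m ∸ suc h) h)) (ℕ.m∸n+n≡m h<m))) ℕ.≤-refl
      (ℕ.≤-trans (ℕ.+-monoˡ-≤ k r≤) (ℕ.≤-reflexive (ℕ.m∸n+n≡m k≤mn))))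
  second (no r≰) = ℕ.≤-trans
    -- `D` is the least value above `r + h`; it is at most `m` because `r < m ∸ suc h`.
    (bound (m * n ∸ k) (suc (m * n ∸ k + h)) ℕ.≤-refl
      (ℕ.≤-trans (s≤s (ℕ.+-monoˡ-≤ h (ℕ.<⇒≤ (ℕ.≰⇒> r≰))))
        (ℕ.≤-reflexive (trans (sym (ℕ.+-suc (m ∸ suc h) h)) (ℕ.m∸n+n≡m h<m))))
      (ℕ.≤-reflexive (ℕ.m∸n+n≡m k≤mn)))
    (ℕ.^-monoʳ-≤ q {_} {m * ((m * n + h + 1) ∸ (k + m))} (ℕ.≤-trans (ℕ.≤-reflexive (cong (_* suc (m * n ∸ k + h)) saturated)) z≤n))
    where
    saturated : m * n ∸ (m * n ∸ k + k) ≡ 0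
    saturated = trans (cong (m * n ∸_) (ℕ.m∸n+n≡m k≤mn)) (ℕ.n∸n≡0 (m * n))
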